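{- Let $n,k\ge 1$. For any $k$-tensor $T$ on $\mathbb{R}^n$, any real $n\times n$ matrices $H_1,\dots,H_k$, any $n\times n$ orthogonal matrix $U$, and any permutation $\sigma$ on $\mathbb{N}_k$ we have the identity $$\langle T, \tilde H_1\circ_\sigma \cdots\circ_\sigma \tilde H_k\rangle = \big(U(\mathrm{Diag}^{\sigma}\,T)U^T\big)[H_1,\dots,H_k],$$ where $\tilde H_i = U^T H_i U$ for all $i=1,\dots,k$.
   Context: $\mathbb{N}_k=\{1,\dots,k\}$. A $k$-tensor $T$ on $\mathbb{R}^n$ is a multilinear real map on $(\mathbb{R}^n)^k$, identified (standard basis) with an array of real entries $T^{i_1\dots i_k}$, $1\le i_s\le n$. Scalar product: $\langle T_1,T_2\rangle=\sum_{i_1,\dots,i_k=1}^n T_1^{i_1\dots i_k}T_2^{i_1\dots i_k}$. $H^{ij}$ denotes the $(i,j)$ entry of a matrix $H$. $\sigma$-Hadamard product: let $H_{pq}$ be the matrix with $1$ in position $(p,q)$ and $0$ elsewhere. For a permutation $\sigma$ on $\mathbb{N}_k$, $(H_{p_1q_1}\circ_\sigma\cdots\circ_\sigma H_{p_kq_k})^{i_1\dots i_k}=1$ if $i_s=p_s=q_{\sigma(s)}$ for all $s=1,\dots,k$, and $0$ otherwise; the product is extended to a $k$-tensor valued map of $k$ matrix arguments, linear in each argument separately. $\mathrm{Diag}^{\sigma}T$ is the $2k$-tensor with entries, indexed by pairs of multi-indices $(i_1\dots i_k;\,j_1\dots j_k)$, equal to $T^{i_1\dots i_k}$ if $i_s=j_{\sigma(s)}$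 for all $s=1,\dots,k$, and $0$ otherwise. For an orthogonal $U$ and a $2k$-tensor $S$ with entries $S^{p_1\dots p_k;\,q_1\dots q_k}$, the $2k$-tensor $USU^T$ is defined by $(USU^T)^{i_1\dots i_k;\,j_1\dots j_k}=\sum_{p_1,q_1,\dots,p_k,q_k=1}^n S^{p_1\dots p_k;\,q_1\dots q_k}\prod_{\nu=1}^k U^{i_\nu p_\nu}U^{j_\nu q_\nu}$. A $2k$-tensor $S$ is evaluated at $k$ matrices by $S[H_1,\dots,H_k]=\sum_{p_1,q_1,\dots,p_k,q_k=1}^n S^{p_1\dots p_k;\,q_1\dots q_k}H_1^{p_1q_1}\cdots H_k^{p_kq_k}$. -}

module Defs where

open import Algebra.Bundles using (CommutativeRing)
open import Data.Bool.Base using (if_then_else_)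
open import Data.Fin.Base using (Fin)
open import Data.Fin.Permutation using (Permutation′; _⟨$⟩ʳ_)
open import Data.Fin.Properties using (_≟_; all?)
open import Data.Nat.Base using (ℕ; zero; suc)
open import Data.Product.Base using (_×_)
open import Data.Vec.Base using (Vec; []; _∷_; lookup)
open import Relation.Nullary.Decidable using (does; _×-dec_)
import Algebra.Properties.Monoid.Sum as MonoidSum

-- The ring R plays the role of the real numbers; nothing beyond its
-- commutative ring structure enters the definitions.

module Tensors {c ℓ} (R : CommutativeRing c ℓ) where

  open CommutativeRing R
  open MonoidSum +-monoid public using (sum)
  open MonoidSum *-monoid public using () renaming (sum to product)

  Matrix : ℕ → Set c
  Matrix n = Fin n → Fin n → Carrier

  -- Multi-indices are vectors rather than functions Fin k → Fin n, so that
  -- componentwise equal multi-indices are propositionally equal and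
  -- every array of entries respects that equality.
  MultiIndex : ℕ → ℕ → Set
  MultiIndex n k = Vec (Fin n) k

  Tensor : ℕ → ℕ → Set c
  Tensor n k = MultiIndex n k → Carrier

  -- 2k-tensors, with entries indexed by pairs (i₁…iₖ ; j₁…jₖ).
  Tensor² : ℕ → ℕ → Set c
  Tensor² n k = MultiIndex n k → MultiIndex n k → Carrier

  sumMulti : ∀ {n} k → (MultiIndex n k → Carrier) → Carrier
  sumMulti zero    f = f []
  sumMulti (suc k) f = sum λ i → sumMulti k λ is → f (i ∷ is)

  infixl 7 _⊗_
  infix  8 _ᵀ
  infix  4 _≈ᴹ_

  _⊗_ : ∀ {n} → Matrix n → Matrix n → Matrix n
  (A ⊗ B) i j = sum λ l → A i l * B l j

  _ᵀ : ∀ {n} → Matrix n → Matrix n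
  (A ᵀ) i j = A j i

  identity : ∀ {n} → Matrix n
  identity i j = if does (i ≟ j) then 1# else 0#

  _≈ᴹ_ : ∀ {n} → Matrix n → Matrix n → Set ℓ
  A ≈ᴹ B = ∀ i j → A i j ≈ B i j

  Orthogonal : ∀ {n} → Matrix n → Set ℓ
  Orthogonal U = (U ᵀ ⊗ U ≈ᴹ identity) × (U ⊗ U ᵀ ≈ᴹ identity)

  ⟨_,_⟩ : ∀ {n k} → Tensor n k → Tensor n k → Carrier
  ⟨_,_⟩ {k = k} T₁ T₂ = sumMulti k λ i → T₁ i * T₂ i

  -- The product of the basis matrices H_{p₁q₁}, …, H_{pₖqₖ}.
  hadamardBasis : ∀ {n k} → Permutation′ k →
                  MultiIndex n k → MultiIndex n k → Tensor n k
  hadamardBasis σ p q i =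
    if does (all? λ s → (lookup i s ≟ lookup p s)
                        ×-dec (lookup p s ≟ lookup q (σ ⟨$⟩ʳ s)))
    then 1# else 0#

  -- Multilinear extension of hadamardBasis, obtained by expanding each
  -- argument as H_s = Σ_{p,q} H_s^{pq} H_{pq}.
  hadamard : ∀ {n k} → Permutation′ k → (Fin k → Matrix n) → Tensor n k
  hadamard {k = k} σ H i =
    sumMulti k λ p → sumMulti k λ q →
      product (λ s → H s (lookup p s) (lookup q s)) * hadamardBasis σ p q i

  Diag : ∀ {n k} → Permutation′ k → Tensor n k → Tensor² n k
  Diag σ T i j =
    if does (all? λ s → lookup i s ≟ lookup j (σ ⟨$⟩ʳ s))
    then T i else 0#

  -- conjugate U S is U S Uᵀ.
  conjugate : ∀ {n k} → Matrix n → Tensor² n k → Tensor² n k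
  conjugate {k = k} U S i j =
    sumMulti k λ p → sumMulti k λ q →
      S p q * product (λ ν → U (lookup i ν) (lookup p ν)
                             * U (lookup j ν) (lookup q ν))

  infix 9 _[_]

  _[_] : ∀ {n k} → Tensor² n k → (Fin k → Matrix n) → Carrier
  _[_] {k = k} S H =
    sumMulti k λ p → sumMulti k λ q →
      S p q * product (λ s → H s (lookup p s) (lookup q s))

-- Summing the defining entries of ∘_σ against T over the multi-index i leaves
-- only i = p, so ⟨ T , K₁ ∘_σ ⋯ ∘_σ Kₖ ⟩ = (Diag σ T)[ K₁ , … , Kₖ ].  Taking
-- K_s = Uᵀ H_s U and expanding the product of the entries of the K_s into one
-- sum over pairs of multi-indices, exchanging the sums moves the factors of U
-- from the matrices to the tensor.
module Submission where

open import Algebra.Bundles using (CommutativeRing)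
open import Data.Bool.Base using (if_then_else_)
open import Data.Fin.Base using (Fin; zero; suc)
open import Data.Fin.Permutation using (Permutation′; _⟨$⟩ʳ_)
open import Data.Fin.Properties using (_≟_; all?)
open import Data.Nat.Base using (ℕ; zero; suc; _≤_)
open import Data.Product.Base using (_,_; proj₁; proj₂)
open import Data.Vec.Base using (Vec; []; _∷_; lookup)
open import Data.Vec.Properties using (∷-injectiveˡ; ∷-injectiveʳ; tabulate∘lookup; tabulate-cong)
open import Function.Base using (_∘_)
open import Relation.Binary.PropositionalEquality as ≡ using (_≡_; _≢_)
open import Relation.Nullary.Decidable using (Dec; yes; no; does; dec-true; dec-false; _×-dec_)
open import Relation.Nullary.Negation using (¬_)
open import Defs
import Algebra.Properties.CommutativeMonoid.Sum as CommutativeMonoidSum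
import Algebra.Properties.CommutativeSemigroup as CommutativeSemigroupProperties
import Algebra.Properties.Semiring.Sum as SemiringSum
import Relation.Binary.Reasoning.Setoid as SetoidReasoning

-- A vector is the tabulation of its own lookups. This lets `i ≢ p`, a statement about whole
-- multi-indices, refute the entrywise test made by `hadamardBasis`.
lookup-ext : ∀ {a} {A : Set a} {k} (xs ys : Vec A k) →
             (∀ s → lookup xs s ≡ lookup ys s) → xs ≡ ys
lookup-ext xs ys eq = ≡.trans (≡.sym (tabulate∘lookup xs))
                      (≡.trans (tabulate-cong eq) (tabulate∘lookup ys))

module TensorProperties {c ℓ} (R : CommutativeRing c ℓ) where

  open CommutativeRing R hiding (zero)
  open Tensors R
  open SemiringSum semiring
    using (sum-cong-≋; sum-replicate-zero; ∑-comm; *-distribˡ-sum; *-distribʳ-sum)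
  open CommutativeMonoidSum *-commutativeMonoid using ()
    renaming (sum-cong-≋ to product-cong; ∑-distrib-+ to product-distrib-*)
  open CommutativeSemigroupProperties *-commutativeSemigroup
    using (x∙yz≈y∙xz; xy∙z≈xz∙y)
  open SetoidReasoning setoid

  -- The decision stays abstract, so a test built from `all?` is resolved by a proof of its
  -- proposition alone, without unfolding the decision procedure.
  if-yes : ∀ {p} {P : Set p} {x y : Carrier} (P? : Dec P) → P →
           (if does P? then x else y) ≈ x
  if-yes P? p = reflexive (≡.cong (if_then _ else _) (dec-true P? p))

  if-no : ∀ {p} {P : Set p} {x y : Carrier} (P? : Dec P) → ¬ P →
          (if does P? then x else y) ≈ y
  if-no P? ¬p = reflexive (≡.cong (if_then _ else _) (dec-false P? ¬p))

  sum-zero : ∀ {n} {f : Fin n → Carrier} → (∀ i → f i ≈ 0#) → sum f ≈ 0#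
  sum-zero {n} f≈0 = trans (sum-cong-≋ f≈0) (sum-replicate-zero n)

  sum-singleton : ∀ {n} {f : Fin n → Carrier} j → (∀ i → i ≢ j → f i ≈ 0#) → sum f ≈ f j
  sum-singleton zero    f≈0 =
    trans (+-congˡ (sum-zero λ i → f≈0 (suc i) λ ())) (+-identityʳ _)
  sum-singleton (suc j) f≈0 =
    trans (+-cong (f≈0 zero λ ()) (sum-singleton j λ i i≢j → f≈0 (suc i) λ { ≡.refl → i≢j ≡.refl }))
          (+-identityˡ _)

  module _ {n : ℕ} where

    sumMulti-cong : ∀ k {f g : MultiIndex n k → Carrier} →
                    (∀ i → f i ≈ g i) → sumMulti k f ≈ sumMulti k g
    sumMulti-cong zero    eq = eq []
    sumMulti-cong (suc k) eq = sum-cong-≋ λ i → sumMulti-cong k λ is → eq (i ∷ is)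

    sumMulti-zero : ∀ k {f : MultiIndex n k → Carrier} →
                    (∀ i → f i ≈ 0#) → sumMulti k f ≈ 0#
    sumMulti-zero zero    f≈0 = f≈0 []
    sumMulti-zero (suc k) f≈0 = sum-zero λ i → sumMulti-zero k λ is → f≈0 (i ∷ is)

    -- Split by the first index: a block whose head differs from that of `j` vanishes entirely, and
    -- the remaining block is a sum over tails, handled by induction.
    sumMulti-singleton : ∀ k {f : MultiIndex n k → Carrier} j →
                         (∀ i → i ≢ j → f i ≈ 0#) → sumMulti k f ≈ f j
    sumMulti-singleton zero    []       f≈0 = refl
    sumMulti-singleton (suc k) (j ∷ js) f≈0 = trans
      (sum-singleton j λ i i≢j → sumMulti-zero k λ is → f≈0 (i ∷ is) (i≢j ∘ ∷-injectiveˡ))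
      (sumMulti-singleton k js λ is is≢js → f≈0 (j ∷ is) (is≢js ∘ ∷-injectiveʳ))

    *-distribˡ-sumMulti : ∀ k x (f : MultiIndex n k → Carrier) →
                          x * sumMulti k f ≈ sumMulti k λ i → x * f i
    *-distribˡ-sumMulti zero    x f = refl
    *-distribˡ-sumMulti (suc k) x f = trans (*-distribˡ-sum {n} x _)
      (sum-cong-≋ λ i → *-distribˡ-sumMulti k x λ is → f (i ∷ is))

    *-distribʳ-sumMulti : ∀ k x (f : MultiIndex n k → Carrier) →
                          sumMulti k f * x ≈ sumMulti k λ i → f i * x
    *-distribʳ-sumMulti zero    x f = refl
    *-distribʳ-sumMulti (suc k) x f = trans (*-distribʳ-sum {n} x _)
      (sum-cong-≋ λ i → *-distribʳ-sumMulti k x λ is → f (i ∷ is))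

    sum-sumMulti-comm : ∀ {m} k (f : Fin m → MultiIndex n k → Carrier) →
      sum (λ i → sumMulti k (f i)) ≈ sumMulti k λ j → sum λ i → f i j
    sum-sumMulti-comm zero    f = refl
    sum-sumMulti-comm (suc k) f = trans (∑-comm λ i j → sumMulti k λ js → f i (j ∷ js))
      (sum-cong-≋ λ j → sum-sumMulti-comm k λ i js → f i (j ∷ js))

    sumMulti-comm : ∀ k l (f : MultiIndex n k → MultiIndex n l → Carrier) →
      sumMulti k (λ i → sumMulti l (f i)) ≈ sumMulti l λ j → sumMulti k λ i → f i j
    sumMulti-comm zero    l f = refl
    sumMulti-comm (suc k) l f = trans
      (sum-cong-≋ λ i → sumMulti-comm k l λ is → f (i ∷ is))
      (sum-sumMulti-comm l λ i j → sumMulti k λ is → f (i ∷ is) j)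

    -- The general distributive law: a multi-index picks one summand from each of the `k` factors.
    -- The inductive step ends by computation, since `product` and `lookup` both unfold at the head
    -- of `i ∷ is`.
    product-sum : ∀ k (f : Fin k → Fin n → Carrier) →
      product (λ s → sum (f s)) ≈ sumMulti k λ i → product λ s → f s (lookup i s)
    product-sum zero    f = refl
    product-sum (suc k) f = begin
      sum (f zero) * product (λ s → sum (f (suc s)))
        ≈⟨ *-congˡ (product-sum k (f ∘ suc)) ⟩
      sum (f zero) * sumMulti k (λ is → product λ s → f (suc s) (lookup is s))
        ≈⟨ *-distribʳ-sum _ (f zero) ⟩
      sum (λ i → f zero i * sumMulti k λ is → product λ s → f (suc s) (lookup is s))
        ≈⟨ (sum-cong-≋ λ i → *-distribˡ-sumMulti k (f zero i) _) ⟩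
      sumMulti (suc k) (λ i → product λ s → f s (lookup i s)) ∎

    -- `hadamard`, `conjugate` and `_[_]` all unfold to sums of this shape, so the laws below apply
    -- to them directly.
    sumMulti² : ∀ k → (MultiIndex n k → MultiIndex n k → Carrier) → Carrier
    sumMulti² k F = sumMulti k λ p → sumMulti k (F p)

    sumMulti²-cong : ∀ k {F G : MultiIndex n k → MultiIndex n k → Carrier} →
                     (∀ p q → F p q ≈ G p q) → sumMulti² k F ≈ sumMulti² k G
    sumMulti²-cong k eq = sumMulti-cong k λ p → sumMulti-cong k (eq p)

    *-distribˡ-sumMulti² : ∀ k x (F : MultiIndex n k → MultiIndex n k → Carrier) →
                           x * sumMulti² k F ≈ sumMulti² k λ p q → x * F p q
    *-distribˡ-sumMulti² k x F = trans (*-distribˡ-sumMulti k x _)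
      (sumMulti-cong k λ p → *-distribˡ-sumMulti k x (F p))

    *-distribʳ-sumMulti² : ∀ k x (F : MultiIndex n k → MultiIndex n k → Carrier) →
                           sumMulti² k F * x ≈ sumMulti² k λ p q → F p q * x
    *-distribʳ-sumMulti² k x F = trans (*-distribʳ-sumMulti k x _)
      (sumMulti-cong k λ p → *-distribʳ-sumMulti k x (F p))

    sumMulti-sumMulti²-comm : ∀ k l (F : MultiIndex n k → MultiIndex n l → MultiIndex n l → Carrier) →
      sumMulti k (λ i → sumMulti² l (F i)) ≈ sumMulti² l λ p q → sumMulti k λ i → F i p q
    sumMulti-sumMulti²-comm k l F = trans
      (sumMulti-comm k l λ i p → sumMulti l (F i p))
      (sumMulti-cong l λ p → sumMulti-comm k l λ i → F i p)

    -- The two outer indices move inside one at a time: first `q` passes the pair `a`, `b`, then `p`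
    -- does.
    sumMulti²-comm : ∀ k l
      (F : MultiIndex n k → MultiIndex n k → MultiIndex n l → MultiIndex n l → Carrier) →
      sumMulti² k (λ p q → sumMulti² l (F p q)) ≈ sumMulti² l λ a b → sumMulti² k λ p q → F p q a b
    sumMulti²-comm k l F = trans
      (sumMulti-cong k λ p → sumMulti-sumMulti²-comm k l (F p))
      (sumMulti-sumMulti²-comm k l λ p a b → sumMulti k λ q → F p q a b)

    -- The test in `hadamardBasis` has two halves. The half `i = p` selects a single summand; the
    -- other half does not involve `i` and is exactly the test in `Diag σ T p q`.
    ⟨T,hadamardBasis⟩ : ∀ {k} (T : Tensor n k) (σ : Permutation′ k) p q →
                        ⟨ T , hadamardBasis σ p q ⟩ ≈ Diag σ T p q
    ⟨T,hadamardBasis⟩ {k} T σ p q = begin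
      ⟨ T , hadamardBasis σ p q ⟩
        ≈⟨ sumMulti-singleton k p (λ i i≢p → trans
             (*-congˡ (if-no (basis? i) λ eq → i≢p (lookup-ext i p (proj₁ ∘ eq)))) (zeroʳ _)) ⟩
      T p * hadamardBasis σ p q p
        ≈⟨ atDiagonal (all? λ s → lookup p s ≟ lookup q (σ ⟨$⟩ʳ s)) ⟩
      Diag σ T p q ∎
      where
      basis? : ∀ i → Dec (∀ s → _)
      basis? i = all? λ s → (lookup i s ≟ lookup p s)
                            ×-dec (lookup p s ≟ lookup q (σ ⟨$⟩ʳ s))

      -- Generalised over the decision, so that matching on it evaluates the conditional that
      -- defines `Diag σ T p q`.
      atDiagonal : (D? : Dec (∀ s → lookup p s ≡ lookup q (σ ⟨$⟩ʳ s))) →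
                   T p * hadamardBasis σ p q p ≈ (if does D? then T p else 0#)
      atDiagonal (yes p≡qσ) =
        trans (*-congˡ (if-yes (basis? p) λ s → ≡.refl , p≡qσ s)) (*-identityʳ _)
      atDiagonal (no p≢qσ)  =
        trans (*-congˡ (if-no (basis? p) λ eq → p≢qσ (proj₂ ∘ eq))) (zeroʳ _)

    -- By linearity the claim reduces to basis matrices: the coefficient `Π p q` is independent of
    -- `i`, so it can be taken out of the scalar product with `T`.
    ⟨T,hadamard⟩ : ∀ {k} (T : Tensor n k) (σ : Permutation′ k) (K : Fin k → Matrix n) →
                   ⟨ T , hadamard σ K ⟩ ≈ Diag σ T [ K ]
    ⟨T,hadamard⟩ {k} T σ K = begin
      sumMulti k (λ i → T i * sumMulti² k λ p q → Π p q * hadamardBasis σ p q i)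
        ≈⟨ (sumMulti-cong k λ i → trans (*-distribˡ-sumMulti² k (T i) _)
             (sumMulti²-cong k λ p q → x∙yz≈y∙xz (T i) _ _)) ⟩
      sumMulti k (λ i → sumMulti² k λ p q → Π p q * (T i * hadamardBasis σ p q i))
        ≈⟨ sumMulti-sumMulti²-comm k k _ ⟩
      sumMulti² k (λ p q → sumMulti k λ i → Π p q * (T i * hadamardBasis σ p q i))
        ≈⟨ (sumMulti²-cong k λ p q → *-distribˡ-sumMulti k (Π p q) _) ⟨
      sumMulti² k (λ p q → Π p q * ⟨ T , hadamardBasis σ p q ⟩)
        ≈⟨ (sumMulti²-cong k λ p q → trans (*-congˡ (⟨T,hadamardBasis⟩ T σ p q)) (*-comm _ _)) ⟩
      Diag σ T [ K ] ∎
      where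
      Π : MultiIndex n k → MultiIndex n k → Carrier
      Π p q = product λ s → K s (lookup p s) (lookup q s)

    -- Each factor is a double sum, over `b` from the outer matrix product and over `a` from the
    -- inner one. Applying `product-sum` once per layer turns these into sums over multi-indices,
    -- and the factors of `U` are then separated from those of `H`.
    product-UᵀHU : ∀ {k} (U : Matrix n) (H : Fin k → Matrix n) p q →
      product (λ s → (U ᵀ ⊗ H s ⊗ U) (lookup p s) (lookup q s)) ≈
      sumMulti² k λ a b → product (λ s → U (lookup a s) (lookup p s) * U (lookup b s) (lookup q s))
                          * product (λ s → H s (lookup a s) (lookup b s))
    product-UᵀHU {k} U H p q = begin
      product (λ s → (U ᵀ ⊗ H s ⊗ U) (lookup p s) (lookup q s))
        ≈⟨ product-sum k _ ⟩
      sumMulti k (λ b → product λ s →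
        (U ᵀ ⊗ H s) (lookup p s) (lookup b s) * U (lookup b s) (lookup q s))
        ≈⟨ (sumMulti-cong k λ b → product-cong {k} λ s → *-distribʳ-sum {n} _ _) ⟩
      sumMulti k (λ b → product λ s → sum λ a →
        U a (lookup p s) * H s a (lookup b s) * U (lookup b s) (lookup q s))
        ≈⟨ (sumMulti-cong k λ b → product-sum k _) ⟩
      sumMulti² k (λ b a → product λ s →
        U (lookup a s) (lookup p s) * H s (lookup a s) (lookup b s) * U (lookup b s) (lookup q s))
        ≈⟨ (sumMulti²-cong k λ b a → trans (product-cong {k} λ s → xy∙z≈xz∙y _ _ _)
             (product-distrib-* {k} _ _)) ⟩
      sumMulti² k (λ b a →
        product (λ s → U (lookup a s) (lookup p s) * U (lookup b s) (lookup q s))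
        * product (λ s → H s (lookup a s) (lookup b s)))
        -- The left-nested matrix product yields `b` as the outer index; evaluation at `H` sums over
        -- the row indices `a` first.
        ≈⟨ sumMulti-comm k k _ ⟩
      sumMulti² k (λ a b →
        product (λ s → U (lookup a s) (lookup p s) * U (lookup b s) (lookup q s))
        * product (λ s → H s (lookup a s) (lookup b s))) ∎

    -- The two sides are one fourfold sum in different orders: contracting `a`, `b` first conjugates
    -- the matrices, contracting `p`, `q` first conjugates the tensor.
    conjugate-[] : ∀ {k} (U : Matrix n) (S : Tensor² n k) (H : Fin k → Matrix n) →
                   S [ (λ s → U ᵀ ⊗ H s ⊗ U) ] ≈ conjugate U S [ H ]
    conjugate-[] {k} U S H = begin
      S [ (λ s → U ᵀ ⊗ H s ⊗ U) ]
        ≈⟨ (sumMulti²-cong k λ p q → *-congˡ (product-UᵀHU U H p q)) ⟩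
      sumMulti² k (λ p q → S p q * sumMulti² k λ a b → ΠU a b p q * ΠH a b)
        ≈⟨ (sumMulti²-cong k λ p q → trans (*-distribˡ-sumMulti² k (S p q) _)
             (sumMulti²-cong k λ a b → sym (*-assoc _ _ _))) ⟩
      sumMulti² k (λ p q → sumMulti² k λ a b → S p q * ΠU a b p q * ΠH a b)
        ≈⟨ sumMulti²-comm k k _ ⟩
      sumMulti² k (λ a b → sumMulti² k λ p q → S p q * ΠU a b p q * ΠH a b)
        -- `ΠH a b` is constant in `p` and `q`; once it is factored out, the inner double sum is the
        -- entry of `conjugate U S` at `a`, `b`.
        ≈⟨ (sumMulti²-cong k λ a b → *-distribʳ-sumMulti² k (ΠH a b) _) ⟨
      conjugate U S [ H ] ∎
      where
      ΠU : (a b p q : MultiIndex n k) → Carrier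
      ΠU a b p q = product λ s → U (lookup a s) (lookup p s) * U (lookup b s) (lookup q s)

      ΠH : (a b : MultiIndex n k) → Carrier
      ΠH a b = product λ s → H s (lookup a s) (lookup b s)

theorem4p4 :
    ∀ {c ℓ} (R : CommutativeRing c ℓ) →
    let open CommutativeRing R using (_≈_)
        open Tensors R
    in
    (n k : ℕ) → 1 ≤ n → 1 ≤ k →
    (T : Tensor n k) (H : Fin k → Matrix n) (U : Matrix n) → Orthogonal U →
    (σ : Permutation′ k) →
    ⟨ T , hadamard σ (λ s → U ᵀ ⊗ H s ⊗ U) ⟩ ≈ (conjugate U (Diag σ T)) [ H ]
theorem4p4 R n k _ _ T H U _ σ =
  trans (⟨T,hadamard⟩ T σ (λ s → U ᵀ ⊗ H s ⊗ U)) (conjugate-[] U (Diag σ T) H)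
  where
  open CommutativeRing R using (trans)
  open Tensors R
  open TensorProperties R
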